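{- There exists a real number $\theta<2/3$ such that for all positive integers $r,s,t$, every 2-increasing sequence of triples from $[r]\times[s]\times[t]$ has length at most $(rst)^{\theta}$.
   Context: $[m]=\{1,\dots,m\}$. For integer triples $a=(a_1,a_2,a_3)$ and $b=(b_1,b_2,b_3)$, write $a<_2b$ if $a_i<b_i$ for at least two indices $i\in\{1,2,3\}$. A sequence $a^1,\dots,a^m$ of triples is 2-increasing if $a^i<_2a^j$ whenever $i<j$. -}

module Defs where

open import Data.Nat using (ℕ; _<_; _≤_)
open import Data.Fin using (Fin) renaming (_<_ to _<ᶠ_)
open import Data.Product using (_×_; _,_)
open import Data.Sum using (_⊎_)

Triple : Set
Triple = ℕ × ℕ × ℕ

_<₂_ : Triple → Triple → Set
(a₁ , a₂ , a₃) <₂ (b₁ , b₂ , b₃) =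
  ((a₁ < b₁) × (a₂ < b₂)) ⊎ ((a₁ < b₁) × (a₃ < b₃)) ⊎ ((a₂ < b₂) × (a₃ < b₃))

InBox : ℕ → ℕ → ℕ → Triple → Set
InBox r s t (a₁ , a₂ , a₃) =
  (1 ≤ a₁ × a₁ ≤ r) × (1 ≤ a₂ × a₂ ≤ s) × (1 ≤ a₃ × a₃ ≤ t)

TwoIncreasing : {m : ℕ} → (Fin m → Triple) → Set
TwoIncreasing {m} a = ∀ (i j : Fin m) → i <ᶠ j → a i <₂ a j

{-# OPTIONS --safe #-}

-- Since a pair of coordinates determines an element, m ≤ rs, m ≤ rt and m ≤ st, so it is
-- enough to gain a power of n over the trivial bound n² when r = s = t = n = K^L.
-- Divide [0, n) into a K-adic tree.  For an element e and a coordinate u, look at the elements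
-- sharing another coordinate v with e.  If they miss a child of the u-block of e at many levels,
-- then e lies in a porous set, which has few elements.  Otherwise e is "full" at most
-- levels: within its box X × Y × Z the elements sharing a coordinate with e meet all the children
-- of X, of Y and of Z.  These three families form chains advancing in step, and
-- comparing with them an element that comes after e forces two of its three coordinates to be
-- at the current front.  So the later elements of the box lie in O(K) subboxes that are
-- K times thinner in two directions.  A box has three directions of L levels each and every
-- factor O(K) uses up two levels, so at most n^(3/2 + small) elements are not porous.
-- Constants are removed by taking tensor powers of the sequence.
module Submission where

open import Defs
open import Data.Nat
open import Data.Nat.Properties
open import Data.Nat.DivMod using (_/_; _%_; m≡m%n+[m/n]*n; m%n<n; /-monoˡ-≤; m<n*o⇒m/o<n)
open import Data.Nat.Tactic.RingSolver using (solve-∀)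
open import Data.Fin using (Fin; toℕ; fromℕ<; combine; join; inject≤; punchOut; punchIn; inject) renaming (_<_ to _<ᶠ_)
import Data.Fin as Fin
import Data.Fin.Properties as Fin
open import Data.Product using (Σ; ∃; _×_; _,_; proj₁; proj₂)
import Data.Product as Product
open import Data.Sum using (_⊎_; inj₁; inj₂)
import Data.Sum as Sum
open import Data.Sum.Properties using (inj₁-injective; inj₂-injective)
open import Data.Empty using (⊥; ⊥-elim)
open import Data.Unit using (⊤; tt)
open import Function using (_∘_)
open import Relation.Nullary using (¬_; Dec; yes; no; contradiction; ¬?)
open import Relation.Nullary.Decidable using (_×-dec_; decidable-stable)
open import Relation.Unary using (Decidable)
open import Relation.Binary.Definitions using (tri<; tri≈; tri>)
open import Relation.Binary.PropositionalEquality

-- Counting by injective codes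

record AtMost {E : Set} (N : ℕ) (P : E → Set) : Set where
  field
    code           : ∀ {e} → P e → Fin N
    code-injective : ∀ {e e′} (p : P e) (p′ : P e′) → code p ≡ code p′ → e ≡ e′
open AtMost

module _ {E : Set} {P : E → Set} where

  atMost-⊆ : ∀ {Q : E → Set} {N} → (∀ {e} → P e → Q e) → AtMost N Q → AtMost N P
  atMost-⊆ P⊆Q Q≤N .code = Q≤N .code ∘ P⊆Q
  atMost-⊆ P⊆Q Q≤N .code-injective p p′ = Q≤N .code-injective (P⊆Q p) (P⊆Q p′)

  atMost-≤ : ∀ {M N} → M ≤ N → AtMost M P → AtMost N P
  atMost-≤ M≤N P≤M .code p = inject≤ (P≤M .code p) M≤N
  atMost-≤ M≤N P≤M .code-injective p p′ eq =
    P≤M .code-injective p p′ (Fin.inject≤-injective M≤N M≤N _ _ eq)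

  atMost-∅ : ∀ {N} → (∀ {e} → ¬ P e) → AtMost N P
  atMost-∅ ∅ .code p = contradiction p ∅
  atMost-∅ ∅ .code-injective p = contradiction p ∅

  atMost-unique : (∀ {e e′} → P e → P e′ → e ≡ e′) → AtMost 1 P
  atMost-unique unique .code _ = Fin.zero
  atMost-unique unique .code-injective p p′ _ = unique p p′

  atMost-∪ : ∀ {Q R : E → Set} {M N} → (∀ {e} → P e → Q e ⊎ R e) →
             AtMost M Q → AtMost N R → AtMost (M + N) P
  atMost-∪ {M = M} {N} P⊆Q∪R Q≤M R≤N .code p =
    join M N (Sum.map (Q≤M .code) (R≤N .code) (P⊆Q∪R p))
  atMost-∪ {M = M} {N} P⊆Q∪R Q≤M R≤N .code-injective p p′ eq =
    lemma (P⊆Q∪R p) (P⊆Q∪R p′)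
      (trans (sym (Fin.splitAt-join M N _))
        (trans (cong (Fin.splitAt M) eq) (Fin.splitAt-join M N _)))
    where
    lemma : ∀ {e e′} s s′ → Sum.map (Q≤M .code {e}) (R≤N .code) s
                          ≡ Sum.map (Q≤M .code {e′}) (R≤N .code) s′ → e ≡ e′
    lemma (inj₁ q) (inj₁ q′) eq = Q≤M .code-injective q q′ (inj₁-injective eq)
    lemma (inj₁ _) (inj₂ _) ()
    lemma (inj₂ _) (inj₁ _) ()
    lemma (inj₂ r) (inj₂ r′) eq = R≤N .code-injective r r′ (inj₂-injective eq)

  atMost-fibres : ∀ {M N} (c : ∀ {e} → P e → Fin M) →
                  (∀ i → AtMost N (λ e → Σ (P e) λ p → c p ≡ i)) → AtMost (M * N) P
  atMost-fibres c fibre≤N .code p = combine (c p) (fibre≤N (c p) .code (p , refl))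
  atMost-fibres {M} {N} c fibre≤N .code-injective {e} {e′} p p′ eq
    with ci , cj ← Fin.combine-injective (c p) _ (c p′) _ eq =
    lemma (c p) refl ci cj
    where
    -- Generalising `c p` to a variable lets the two fibres be identified by matching on `refl`.
    lemma : ∀ i (q : c p ≡ i) (ci : i ≡ c p′) →
            fibre≤N i .code (p , q) ≡ fibre≤N (c p′) .code (p′ , refl) → e ≡ e′
    lemma i q refl cj = fibre≤N i .code-injective (p , q) (p′ , refl) cj

atMost-all : ∀ {m N} {P : Fin m → Set} → (∀ e → P e) → AtMost N P → m ≤ N
atMost-all all P≤N =
  Fin.injective⇒≤ {f = λ e → P≤N .code (all e)} (P≤N .code-injective (all _) (all _))

-- Lets a bound be stated in terms of an element of `P`; if there is none, nothing has to be
-- counted.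
atMost-pointed : ∀ {m N} {P : Fin m → Set} → Decidable P → (∀ {e} → P e → AtMost N P) → AtMost N P
atMost-pointed P? pointed with Fin.any? P?
... | yes (_ , p) = pointed p
... | no ∄p = atMost-∅ (λ p → ∄p (_ , p))

first : ∀ {m} {P : Fin m → Set} → Decidable P → ∀ {e} → P e →
        ∃ λ e₀ → P e₀ × (∀ {e} → P e → e₀ ≡ e ⊎ e₀ <ᶠ e)
first {m} {P} P? {e} p
  with e₀ , ¬¬p₀ , before ← Fin.¬∀⟶∃¬-smallest m (¬_ ∘ P) (¬? ∘ P?) (λ ∀¬ → ∀¬ e p) =
  e₀ , decidable-stable (P? e₀) ¬¬p₀ , later
  where
  later : ∀ {e} → P e → e₀ ≡ e ⊎ e₀ <ᶠ e
  later {e} p with Fin.<-cmp e₀ e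
  ... | tri< e₀<e _ _ = inj₂ e₀<e
  ... | tri≈ _ e₀≡e _ = inj₁ e₀≡e
  ... | tri> _ _ e<e₀ = contradiction (subst P (sym e≡) p) (before (fromℕ< e<e₀))
    where
    e≡ : inject (fromℕ< e<e₀) ≡ e
    e≡ = Fin.toℕ-injective (trans (Fin.toℕ-inject (fromℕ< e<e₀)) (Fin.toℕ-fromℕ< e<e₀))

-- 2-increasing sequences by coordinates

record Increasing {m} (u v w : Fin m → ℕ) : Set where
  field
    step : ∀ {i j} → i <ᶠ j → (u i , v i , w i) <₂ (u j , v j , w j)
open Increasing

module _ {m} {u v w : Fin m → ℕ} (inc : Increasing u v w) where

  -- The order is symmetric in the coordinates. Together with `swap₂₃` this generates all
  -- permutations, so each later lemma treats a single arrangement.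
  swap₁₂ : Increasing v u w
  swap₁₂ .step i<j with inc .step i<j
  ... | inj₁ (u< , v<) = inj₁ (v< , u<)
  ... | inj₂ (inj₁ (u< , w<)) = inj₂ (inj₂ (u< , w<))
  ... | inj₂ (inj₂ (v< , w<)) = inj₂ (inj₁ (v< , w<))

  swap₂₃ : Increasing u w v
  swap₂₃ .step i<j with inc .step i<j
  ... | inj₁ (u< , v<) = inj₂ (inj₁ (u< , v<))
  ... | inj₂ (inj₁ (u< , w<)) = inj₁ (u< , w<)
  ... | inj₂ (inj₂ (v< , w<)) = inj₂ (inj₂ (w< , v<))

  -- Of the three pairs of coordinates that may increase, only one avoids `u`.
  stuck : ∀ {i j} → i <ᶠ j → u j ≤ u i → v i < v j × w i < w j
  stuck i<j u≥ with inc .step i<j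
  ... | inj₁ (u< , _) = contradiction u≥ (<⇒≱ u<)
  ... | inj₂ (inj₁ (u< , _)) = contradiction u≥ (<⇒≱ u<)
  ... | inj₂ (inj₂ v<w<) = v<w<

  -- If `j` came first, `u` would not increase from `j` to `i`, so `v` would have to.
  before : ∀ {i j} → u i < u j → v i ≤ v j → i <ᶠ j
  before {i} {j} u< v≤ with Fin.<-cmp i j
  ... | tri< i<j _ _ = i<j
  ... | tri≈ _ refl _ = contradiction u< (<-irrefl refl)
  ... | tri> _ _ j<i = contradiction v≤ (<⇒≱ (proj₁ (stuck j<i (<⇒≤ u<))))

  third : ∀ {i j} → u i < u j → v i ≡ v j → w i < w j
  third {i} {j} u< v≡ with inc .step (before u< (≤-reflexive v≡))
  ... | inj₁ (_ , v<) = contradiction v≡ (<⇒≢ v<)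
  ... | inj₂ (inj₁ (_ , w<)) = w<
  ... | inj₂ (inj₂ (v< , _)) = contradiction v≡ (<⇒≢ v<)

  pair-injective : ∀ {i j} → u i ≡ u j → v i ≡ v j → i ≡ j
  pair-injective {i} {j} u≡ v≡ with Fin.<-cmp i j
  ... | tri< i<j _ _ = contradiction v≡ (<⇒≢ (proj₁ (stuck i<j (≤-reflexive (sym u≡)))))
  ... | tri≈ _ i≡j _ = i≡j
  ... | tri> _ _ j<i = contradiction (sym v≡) (<⇒≢ (proj₁ (stuck j<i (≤-reflexive u≡))))

-- The K-adic tree, visited blocks and fronts

module Blocks (κ : ℕ) where

  K : ℕ
  K = suc κ

  -- The quotient of `x` by `K ^ l`. Dividing one level at a time makes the parent of a block its
  -- quotient by `K` by definition.
  block : ℕ → ℕ → ℕ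
  block zero    x = x
  block (suc l) x = block l x / K

  block-mono-≤ : ∀ l {x y} → x ≤ y → block l x ≤ block l y
  block-mono-≤ zero    x≤y = x≤y
  block-mono-≤ (suc l) x≤y = /-monoˡ-≤ K (block-mono-≤ l x≤y)

  block-cancel-< : ∀ l {x y} → block l x < block l y → x < y
  block-cancel-< l lt = ≰⇒> λ y≤x → <⇒≱ lt (block-mono-≤ l y≤x)

  block-< : ∀ l {x B} → x < B * K ^ l → block l x < B
  block-< zero    {x} {B} lt = subst (x <_) (*-identityʳ B) lt
  block-< (suc l) {x} {B} lt = m<n*o⇒m/o<n (block-< l (subst (x <_) (sym (*-assoc B K (K ^ l))) lt))

  block-≡0 : ∀ l {x} → x < K ^ l → block l x ≡ 0
  block-≡0 l {x} lt = n<1⇒n≡0 (block-< l (subst (x <_) (sym (*-identityˡ (K ^ l))) lt))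

  digit : ℕ → ℕ → Fin K
  digit l x = fromℕ< (m%n<n (block l x) K)

  block-digit : ∀ l x → block l x ≡ toℕ (digit l x) + block (suc l) x * K
  block-digit l x = trans (m≡m%n+[m/n]*n (block l x) K)
    (cong (_+ block (suc l) x * K) (sym (Fin.toℕ-fromℕ< (m%n<n (block l x) K))))

  between : ∀ {B B₁ B₂ A} → B₁ ≤ B → B ≤ B₂ → B₁ / K ≡ A → B₂ / K ≡ A → B / K ≡ A
  between {B} B₁≤B B≤B₂ refl B₂≡ =
    ≤-antisym (subst (B / K ≤_) B₂≡ (/-monoˡ-≤ K B≤B₂)) (/-monoˡ-≤ K B₁≤B)

  module _ {m : ℕ} where

    Coord : Set
    Coord = Fin m → ℕ

    -- The blocks `toℕ c + A * K` are the children of block `A`. The slice `V` and the parent `A`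
    -- are free parameters, so that one decision serves a whole column in the porous count.
    VisitsAll : (u v : Coord) → ℕ → (V A : ℕ) → Set
    VisitsAll u v l V A = ∀ (c : Fin K) → ∃ λ g → v g ≡ V × block l (u g) ≡ toℕ c + A * K

    visitsAll? : ∀ u v l V A → Dec (VisitsAll u v l V A)
    visitsAll? u v l V A = Fin.all? λ c → Fin.any? λ g →
      (v g ≟ V) ×-dec (block l (u g) ≟ toℕ c + A * K)

    Visits : (u v : Coord) → ℕ → Fin m → Set
    Visits u v l e = VisitsAll u v l (v e) (block (suc l) (u e))

    visit : ∀ u v l {e} → Visits u v l e → ∀ B → B / K ≡ block (suc l) (u e) →
            ∃ λ g → v g ≡ v e × block l (u g) ≡ B
    visit u v l vis B B/K≡ with g , v≡ , g≡ ← vis (fromℕ< (m%n<n B K)) =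
      g , v≡ , trans g≡ (sym (trans (m≡m%n+[m/n]*n B K)
        (cong₂ (λ c A → c + A * K) (sym (Fin.toℕ-fromℕ< (m%n<n B K))) B/K≡)))

    Sibling : Coord → ℕ → (e e′ : Fin m) → Set
    Sibling u l e e′ = block (suc l) (u e′) ≡ block (suc l) (u e)

    -- The margin of two blocks leaves a block strictly in between for a visiting element.
    Behind : (u v : Coord) → ℕ → (e e′ : Fin m) → Set
    Behind u v l e e′ = ∃ λ g →
      v g ≡ v e × Sibling u l e g × 2 + block l (u e′) ≤ block l (u g) × g <ᶠ e′

    behind? : ∀ u v l e e′ → Dec (Behind u v l e e′)
    behind? u v l e e′ = Fin.any? λ g → (v g ≟ v e) ×-dec
      ((block (suc l) (u g) ≟ block (suc l) (u e)) ×-dec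
      ((2 + block l (u e′) ≤? block l (u g)) ×-dec (g Fin.<? e′)))

    WeaklyBehind : (u v : Coord) → (e e′ : Fin m) → Set
    WeaklyBehind u v e e′ = ∃ λ g → v g ≡ v e × u e′ < u g × g <ᶠ e′

    -- Two chains start from `e`: the elements sharing `v` with it, ordered by `u`, and those
    -- sharing `u`, ordered by `v`. No chain element inside the parent block that precedes `e′` in
    -- the sequence is beyond `e′` by the margin.
    Front : (u v : Coord) → ℕ → ℕ → (e e′ : Fin m) → Set
    Front u v l l′ e e′ =
      u e < u e′ × v e < v e′ × ¬ Behind u v l e e′ × ¬ Behind v u l′ e e′

    front? : ∀ u v l l′ e e′ → Dec (Front u v l l′ e e′)
    front? u v l l′ e e′ = (u e <? u e′) ×-dec ((v e <? v e′) ×-dec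
      (¬? (behind? u v l e e′) ×-dec ¬? (behind? v u l′ e e′)))

    weaken : ∀ {u v l e e′} → Behind u v l e e′ → WeaklyBehind u v e e′
    weaken {l = l} (g , v≡ , _ , gap , g<) = g , v≡ , block-cancel-< l (<⇒≤ gap) , g<

    module _ {u v w : Coord} (inc : Increasing u v w) where

      -- The witnesses `g` and `h` lie in one `w`-slice, where `u` and `v` must both follow the
      -- order of the sequence. But `e′` separates them in opposite directions: `u h < u e′ < u g`
      -- and `v g < v e′ < v h`.
      clash : ∀ {e e′} → WeaklyBehind u w e e′ → WeaklyBehind v w e e′ → ⊥
      clash {e} {e′} (g , wg≡ , ug> , g<) (h , wh≡ , vh> , h<) =
        Fin.<-asym (before (swap₂₃ inc) (<-trans uh< ug>) (≤-reflexive (trans wh≡ (sym wg≡))))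
                   (before (swap₂₃ (swap₁₂ inc)) (<-trans vg< vh>) (≤-reflexive (trans wg≡ (sym wh≡))))
        where
        vg< : v g < v e′
        vg< = proj₁ (stuck inc g< (<⇒≤ ug>))
        uh< : u h < u e′
        uh< = proj₁ (stuck (swap₁₂ inc) h< (<⇒≤ vh>))

      -- Moves a witness from the `v`-slice to the `w`-slice of `e`. The visit to the block right
      -- after that of `e′` gives `h`, and the margin puts `h` strictly below `g` in `u`. Since
      -- `w h` equals `w e`, which is below `w g`, `h` precedes `g` and hence `e′`.
      transfer : ∀ {l e e′} → u e < u e′ → Sibling u l e e′ → Visits u w l e →
                 Behind u v l e e′ → WeaklyBehind u w e e′
      transfer {l} {e} {e′} u< sib vis (g , vg≡ , sibg , gap , g<)
        with h , wh≡ , h≡ ← visit u w l vis (suc (block l (u e′)))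
                              (between (n≤1+n _) (<⇒≤ gap) sib sibg) =
        h , wh≡ , e′<h , Fin.<-trans (before (swap₂₃ inc) h<g (<⇒≤ wh<)) g<
        where
        e′<h : u e′ < u h
        e′<h = block-cancel-< l (≤-reflexive (sym h≡))
        h<g : u h < u g
        h<g = block-cancel-< l (subst (_< block l (u g)) (sym h≡) gap)
        wh< : w h < w g
        wh< = subst (_< w g) (sym wh≡) (third inc (<-trans u< (<-trans e′<h h<g)) (sym vg≡))

      -- A chain element `g` beyond `e′` has `w e < w g` by `third`. Preceding `e′` while ahead of
      -- it in one coordinate, it also has `w g < w e′`, against `w e′ ≤ w e`.
      front-of-low : ∀ {l l′ e e′} → e <ᶠ e′ → w e′ ≤ w e → Front u v l l′ e e′
      front-of-low {l} {l′} {e} {e′} e<e′ w≥ =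
        u< , v< , ¬behind u v (swap₁₂ inc) l u< , ¬behind v u inc l′ v<
        where
        u<v< : u e < u e′ × v e < v e′
        u<v< = stuck (swap₁₂ (swap₂₃ inc)) e<e′ w≥
        u< = proj₁ u<v<
        v< = proj₂ u<v<
        ¬behind : ∀ s t → Increasing t s w → ∀ l → s e < s e′ → ¬ Behind s t l e e′
        ¬behind s t inc′ l s< (g , tg≡ , _ , gap , g<) =
          <⇒≱ (<-trans (third (swap₁₂ inc′) (<-trans s< s′<g) (sym tg≡))
                       (proj₂ (stuck (swap₁₂ inc′) g< (<⇒≤ s′<g)))) w≥
          where
          s′<g : s e′ < s g
          s′<g = block-cancel-< l (<⇒≤ gap)

      -- Visiting elements between the two blocks would place e′ before e″ (via u) and e″ before e′ (via v).
      front-tube : ∀ {l l′ e e′ e″} → Visits u v l e → Visits v u l′ e →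
        Front u v l l′ e e′ → Front u v l l′ e e″ →
        Sibling u l e e′ → Sibling u l e e″ → Sibling v l′ e e′ → Sibling v l′ e e″ →
        3 + block l (u e′) ≤ block l (u e″) → 3 + block l′ (v e″) ≤ block l′ (v e′) → ⊥
      front-tube {l} {l′} {e} {e′} {e″} visu visv
        (u′ , v′ , ¬bu , _) (u″ , v″ , _ , ¬bv) su′ su″ sv′ sv″ ugap vgap =
        Fin.<-asym (overtakes u v inc l su′ su″ visu ¬bu v″ ugap)
                   (overtakes v u (swap₁₂ inc) l′ sv″ sv′ visv ¬bv u′ vgap)
        where
        overtakes : ∀ s t → Increasing s t w → ∀ l {e′ e″} → Sibling s l e e′ → Sibling s l e e″ →
          Visits s t l e → ¬ Behind s t l e e′ → t e < t e″ →
          3 + block l (s e′) ≤ block l (s e″) → e′ <ᶠ e″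
        overtakes s t inc′ l {e′} {e″} sib′ sib″ vis ¬b t< gap
          with parent ← between (m≤n+m (block l (s e′)) 2) (<⇒≤ gap) sib′ sib″
          with g , tg≡ , g≡ ← visit s t l vis (2 + block l (s e′)) parent =
          ≤-<-trans
            (≮⇒≥ λ g< → ¬b (g , tg≡ , trans (cong (_/ K) g≡) parent , ≤-reflexive (sym g≡) , g<))
            (before inc′ (block-cancel-< l (subst (_< block l (s e″)) (sym g≡) gap))
                         (<⇒≤ (subst (_< t e″) (sym tg≡) t<)))

-- Gaps between block indices

mod3-gap : ∀ {a b} → a % 3 ≡ b % 3 → a < b → 3 + a ≤ b
mod3-gap {a} {b} a≡b a<b = begin
  3 + a                       ≡⟨ cong (3 +_) (m≡m%n+[m/n]*n a 3) ⟩
  3 + (a % 3 + a / 3 * 3)     ≡⟨ x∙yz≈y∙xz 3 (a % 3) (a / 3 * 3) ⟩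
  a % 3 + suc (a / 3) * 3     ≤⟨ +-monoʳ-≤ (a % 3) (*-monoˡ-≤ 3 a/3<b/3) ⟩
  a % 3 + b / 3 * 3           ≡⟨ cong (_+ b / 3 * 3) a≡b ⟩
  b % 3 + b / 3 * 3           ≡⟨ m≡m%n+[m/n]*n b 3 ⟨
  b                           ∎
  where
  open ≤-Reasoning
  open import Algebra.Properties.CommutativeSemigroup +-commutativeSemigroup using (x∙yz≈y∙xz)
  a/3<b/3 : a / 3 < b / 3
  a/3<b/3 = ≰⇒> λ b/3≤a/3 → <⇒≱ a<b (begin
    b                  ≡⟨ m≡m%n+[m/n]*n b 3 ⟩
    b % 3 + b / 3 * 3  ≤⟨ +-mono-≤ (≤-reflexive (sym a≡b)) (*-monoˡ-≤ 3 b/3≤a/3) ⟩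
    a % 3 + a / 3 * 3  ≡⟨ m≡m%n+[m/n]*n a 3 ⟨
    a                  ∎)

complementary-gap : ∀ {a b c d k} → a + b ≡ c + d → k + a ≤ c → k + d ≤ b
complementary-gap {a} {b} {c} {d} {k} sum≡ k+a≤c = +-cancelˡ-≤ a (k + d) b (begin
  a + (k + d)  ≡⟨ x∙yz≈yx∙z a k d ⟩
  (k + a) + d  ≤⟨ +-monoˡ-≤ d k+a≤c ⟩
  c + d        ≡⟨ sum≡ ⟨
  a + b        ∎)
  where
  open ≤-Reasoning
  open import Algebra.Properties.CommutativeSemigroup +-commutativeSemigroup using (x∙yz≈yx∙z)

-- Counting porous sets and fronts

missed : {A : Set} → Dec A → ℕ
missed (yes _) = 0
missed (no  _) = 1

missed-yes : {A : Set} (d : Dec A) → A → missed d ≡ 0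
missed-yes (yes _) _ = refl
missed-yes (no ¬a) a = contradiction a ¬a

missed-no : {A : Set} (d : Dec A) → ¬ A → missed d ≡ 1
missed-no (yes a) ¬a = contradiction a ¬a
missed-no (no _)  _  = refl

missed≤1 : {A : Set} (d : Dec A) → missed d ≤ 1
missed≤1 (yes _) = z≤n
missed≤1 (no _)  = ≤-refl

missed-× : {A B : Set} (d : Dec A) (d′ : Dec B) → ¬ (A × B) → 1 ≤ missed d + missed d′
missed-× (yes a) (yes b) ¬ab = contradiction (a , b) ¬ab
missed-× (yes _) (no _)  _   = ≤-refl
missed-× (no _)  _       _   = s≤s z≤n

module Counting (κ : ℕ) where
  open Blocks κ

  module _ {m : ℕ} where

    visits? : ∀ (u v : Coord {m}) l e → Dec (Visits u v l e)
    visits? u v l e = visitsAll? u v l (v e) (block (suc l) (u e))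

    misses : (u v : Coord {m}) → ℕ → Fin m → ℕ
    misses u v zero    e = 0
    misses u v (suc l) e = missed (visits? u v l e) + misses u v l e

    misses≤ : ∀ u v l e → misses u v l e ≤ l
    misses≤ u v zero    e = z≤n
    misses≤ u v (suc l) e = +-mono-≤ (missed≤1 (visits? u v l e)) (misses≤ u v l e)

    misses-mono : ∀ u v l e → misses u v l e ≤ misses u v (suc l) e
    misses-mono u v l e = m≤n+m _ _

    misses-step : ∀ u v w l e → ¬ (Visits u v l e × Visits u w l e) →
      suc (misses u v l e + misses u w l e) ≤ misses u v (suc l) e + misses u w (suc l) e
    misses-step u v w l e ¬ok = begin
      suc (p + q)         ≤⟨ +-monoˡ-≤ (p + q) (missed-× (visits? u v l e) (visits? u w l e) ¬ok) ⟩
      (d + d′) + (p + q)  ≡⟨ interchange d d′ p q ⟩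
      (d + p) + (d′ + q)  ∎
      where
      open ≤-Reasoning
      open import Algebra.Properties.CommutativeSemigroup +-commutativeSemigroup using (interchange)
      p = misses u v l e
      q = misses u w l e
      d = missed (visits? u v l e)
      d′ = missed (visits? u w l e)

    digit-fibre : ∀ l {x A i} → block (suc l) x ≡ A → digit l x ≡ i → block l x ≡ toℕ i + A * K
    digit-fibre l {x} refl refl = block-digit l x

    atMost-column : ∀ {P : Fin m → Set} (u : Coord {m}) l A → (∀ {e} → P e → block l (u e) ≡ A) →
      (∀ {e e′} → P e → P e′ → u e ≡ u e′ → e ≡ e′) → AtMost (K ^ l) P
    atMost-column u zero    A inA inj = atMost-unique λ p p′ → inj p p′ (trans (inA p) (sym (inA p′)))
    atMost-column u (suc l) A inA inj = atMost-fibres (λ {e} _ → digit l (u e)) λ i →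
      atMost-column u l (toℕ i + A * K) (λ (p , d≡) → digit-fibre l (inA p) d≡)
        (λ (p , _) (p′ , _) → inj p p′)

    module _ {u v w : Coord {m}} (inc : Increasing u v w) where

      Porous : (V l A β : ℕ) → Fin m → Set
      Porous V l A β e = (v e ≡ V × block l (u e) ≡ A) × β ≤ misses u v l e

      -- A level with a missed child leaves at most `κ` of the `K` children and pays for one unit of
      -- `β`; any other level keeps `β` and may use all `K` children.
      atMost-porous-column : ∀ V l A β → AtMost (K ^ (l ∸ β) * κ ^ β) (Porous V l A β)
      -- The branch in which the requirement `β` passes unchanged to the children.
      atMost-porous-children : ∀ V l A β →
        (∀ {e} → Porous V (suc l) A β e → β ≤ misses u v l e) →
        AtMost (K ^ (suc l ∸ β) * κ ^ β) (Porous V (suc l) A β)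

      atMost-porous-column V zero A zero =
        atMost-unique λ ((v≡ , u≡) , _) ((v≡′ , u≡′) , _) →
          pair-injective inc (trans u≡ (sym u≡′)) (trans v≡ (sym v≡′))
      atMost-porous-column V zero A (suc β) = atMost-∅ λ { (_ , ()) }
      atMost-porous-column V (suc l) A zero = atMost-porous-children V l A 0 λ _ → z≤n
      atMost-porous-column V (suc l) A (suc β) with visitsAll? u v l V A
      ... | yes vis = atMost-porous-children V l A (suc β) λ {e} ((v≡ , u≡) , β≤) →
              subst (λ d → suc β ≤ d + misses u v l e)
                (missed-yes (visits? u v l e) (subst₂ (VisitsAll u v l) (sym v≡) (sym u≡) vis)) β≤
      ... | no ¬vis
        with c , empty ← Fin.¬∀⟶∃¬ K _ (λ c → Fin.any? λ g → (v g ≟ V) ×-dec (block l (u g) ≟ toℕ c + A * K)) ¬vis =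
        subst (λ N → AtMost N (Porous V (suc l) A (suc β))) (x∙yz≈y∙xz κ (K ^ (l ∸ β)) (κ ^ β))
          (atMost-fibres {P = Porous V (suc l) A (suc β)}
            -- Removing the empty child `c` leaves `κ` labels for the children.
            (λ p → punchOut (c≢ p)) λ i →
            atMost-⊆ (λ {e} (p@((v≡ , u≡) , β<) , d≡) →
                (v≡ , digit-fibre l u≡ (trans (sym (Fin.punchIn-punchOut (c≢ p))) (cong (punchIn c) d≡))) ,
                s≤s⁻¹ (subst (λ d → suc β ≤ d + misses u v l e)
                  (missed-no (visits? u v l e) (subst₂ (λ V A → ¬ VisitsAll u v l V A) (sym v≡) (sym u≡) ¬vis)) β<))
              (atMost-porous-column V l (toℕ (punchIn c i) + A * K) β))
        where
        open import Algebra.Properties.CommutativeSemigroup *-commutativeSemigroup using (x∙yz≈y∙xz)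
        c≢ : ∀ {e} → Porous V (suc l) A (suc β) e → c ≢ digit l (u e)
        c≢ {e} ((v≡ , u≡) , _) c≡ = empty (e , v≡ , digit-fibre l u≡ (sym c≡))

      atMost-porous-children V l A β same with β ≤? l
      -- Only `l` levels remain, so a larger `β` leaves nothing to count. Otherwise `suc l ∸ β` is a
      -- true difference and a factor `K` splits off.
      ... | no β≰l = atMost-∅ λ {e} p → β≰l (≤-trans (same p) (misses≤ u v l e))
      ... | yes β≤l rewrite +-∸-assoc 1 β≤l | *-assoc K (K ^ (l ∸ β)) (κ ^ β) =
        atMost-fibres (λ {e} _ → digit l (u e)) λ i →
          atMost-⊆ (λ (p@((v≡ , u≡) , β≤) , d≡) → (v≡ , digit-fibre l u≡ d≡) , same p)
            (atMost-porous-column V l (toℕ i + A * K) β)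

      atMost-porous : ∀ L β → (∀ e → u e < K ^ L) → (∀ e → v e < K ^ L) →
        AtMost (K ^ L * (K ^ (L ∸ β) * κ ^ β)) (λ e → β ≤ misses u v L e)
      atMost-porous L β u< v< = atMost-fibres (λ {e} _ → fromℕ< (v< e)) λ V →
        atMost-⊆ (λ {e} (β≤ , V≡) →
            (trans (sym (Fin.toℕ-fromℕ< (v< e))) (cong toℕ V≡) , block-≡0 L (u< e)) , β≤)
          (atMost-porous-column (toℕ V) L 0 β)

      digitSum : ℕ → ℕ → Fin m → ℕ
      digitSum l l′ e = toℕ (digit l (u e)) + toℕ (digit l′ (v e))

      digitSum< : ∀ l l′ e → digitSum l l′ e < K + K
      digitSum< l l′ e = +-mono-< (Fin.toℕ<n (digit l (u e))) (Fin.toℕ<n (digit l′ (v e)))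

      -- Two front elements with equal digit sums differ by at most two blocks in u.
      frontCode : ℕ → ℕ → Fin m → Fin ((K + K) * 3)
      frontCode l l′ e = combine (fromℕ< (digitSum< l l′ e)) (fromℕ< (m%n<n (block l (u e)) 3))

      -- The parent blocks are those of `e₀`, so equal codes give equal sums of block indices.
      -- Distinct `u`-blocks with equal residues are at least three apart, and the equal sums then
      -- force the opposite gap in `v`, which `front-tube` excludes. Each code thus selects one pair
      -- of blocks.
      atMost-front : ∀ {l l′ e₀ N} {P : Fin m → Set} → Decidable P →
        Visits u v l e₀ → Visits v u l′ e₀ →
        (∀ {e} → P e → Front u v l l′ e₀ e × Sibling u l e₀ e × Sibling v l′ e₀ e) →
        (∀ A B → AtMost N (λ e → P e × block l (u e) ≡ A × block l′ (v e) ≡ B)) →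
        AtMost ((K + K) * 3 * N) P
      atMost-front {l} {l′} {e₀} {P = P} P? visu visv front tube≤N =
        atMost-fibres (λ {e} _ → frontCode l l′ e) λ i →
          -- The pair of blocks belonging to a code is read off any element with that code.
          atMost-pointed (λ e → P? e ×-dec (frontCode l l′ e Fin.≟ i))
            λ {e} (p , c≡) → atMost-⊆
              (λ {e′} (p′ , c≡′) → p′ , same p′ p (trans c≡′ (sym c≡)))
              (tube≤N (block l (u e)) (block l′ (v e)))
        where
        split : ∀ {e} → P e → block l (u e) + block l′ (v e) ≡
          digitSum l l′ e + (block (suc l) (u e₀) * K + block (suc l′) (v e₀) * K)
        split {e} p with _ , su , sv ← front p =
          trans (cong₂ _+_ (digit-fibre l su refl) (digit-fibre l′ sv refl))
            (interchange (toℕ (digit l (u e))) _ (toℕ (digit l′ (v e))) _)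
          where
          open import Algebra.Properties.CommutativeSemigroup +-commutativeSemigroup using (interchange)

        gapless : ∀ {e e′} → P e → P e′ → block l (u e) + block l′ (v e) ≡ block l (u e′) + block l′ (v e′) →
                  block l (u e) % 3 ≡ block l (u e′) % 3 → ¬ block l (u e) < block l (u e′)
        gapless {e} p p′ sum≡ mod≡ lt
          with fr , su , sv ← front p
          with fr′ , su′ , sv′ ← front p′ =
          front-tube inc {l} {l′} visu visv fr fr′ su su′ sv sv′ (mod3-gap mod≡ lt)
            (complementary-gap {block l (u e)} sum≡ (mod3-gap mod≡ lt))

        same : ∀ {e e′} → P e → P e′ → frontCode l l′ e ≡ frontCode l l′ e′ →
               block l (u e) ≡ block l (u e′) × block l′ (v e) ≡ block l′ (v e′)
        same {e} {e′} p p′ c≡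
          with sum≡F , mod≡F ← Fin.combine-injective
            (fromℕ< (digitSum< l l′ e)) (fromℕ< (m%n<n (block l (u e)) 3))
            (fromℕ< (digitSum< l l′ e′)) (fromℕ< (m%n<n (block l (u e′)) 3)) c≡ =
          u≡ , +-cancelˡ-≡ (block l (u e)) _ _ (trans sum≡ (cong (_+ block l′ (v e′)) (sym u≡)))
          where
          mod≡ : block l (u e) % 3 ≡ block l (u e′) % 3
          mod≡ = Fin.fromℕ<-injective _ _ _ _ mod≡F
          sum≡ : block l (u e) + block l′ (v e) ≡ block l (u e′) + block l′ (v e′)
          sum≡ = trans (split p) (trans (cong (_+ (block (suc l) (u e₀) * K + block (suc l′) (v e₀) * K)) (Fin.fromℕ<-injective _ _ _ _ sum≡F)) (sym (split p′)))
          u≡ : block l (u e) ≡ block l (u e′)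
          u≡ = ≤-antisym (≮⇒≥ (gapless p′ p (sym sum≡) (sym mod≡))) (≮⇒≥ (gapless p p′ sum≡ mod≡))

-- Boxes with a budget of misses

module BoxCounting (κ γ : ℕ) .{{_ : NonZero γ}}
  (γ-large : 3 * γ + (1 + 3 * ((suc κ + suc κ) * 3)) ≤ γ * γ)
  {m : ℕ} {x y z : Fin m → ℕ} (inc : Increasing x y z) where
  open Blocks κ
  open Counting κ

  Full : (a b c : ℕ) → Fin m → Set
  Full a b c e = (Visits x y a e × Visits x z a e) ×
           (Visits y x b e × Visits y z b e) ×
           (Visits z x c e × Visits z y c e)

  front-or-behind : ∀ (u v : Fin m → ℕ) l l′ {e e′} → u e < u e′ → v e < v e′ →
    Front u v l l′ e e′ ⊎ (Behind u v l e e′ ⊎ Behind v u l′ e e′)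
  front-or-behind u v l l′ {e} {e′} u< v< with behind? u v l e e′ | behind? v u l′ e e′
  ... | yes bu | _      = inj₂ (inj₁ bu)
  ... | no _   | yes bv = inj₂ (inj₂ bv)
  ... | no ¬bu | no ¬bv = inj₁ (u< , v< , ¬bu , ¬bv)

  -- If a coordinate does not increase, `front-of-low` gives a front in the other two. Otherwise,
  -- failing all three fronts means being behind in each pair. Whichever chains are responsible, two
  -- of them lie in a common slice, if need be after `transfer`, and `clash` applies.
  front-cover : ∀ a b c {e e′} → Full a b c e → e <ᶠ e′ → Sibling x a e e′ → Sibling y b e e′ →
    Front x y a b e e′ ⊎ Front x z a c e e′ ⊎ Front y z b c e e′
  front-cover a b c {e} {e′} ((_ , xz) , (_ , yz) , _) e< sx sy
    with x e <? x e′ | y e <? y e′ | z e <? z e′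
  ... | no x≮ | _ | _ = inj₂ (inj₂ (front-of-low (swap₂₃ (swap₁₂ inc)) {b} {c} e< (≮⇒≥ x≮)))
  ... | yes _ | no y≮ | _ = inj₂ (inj₁ (front-of-low (swap₂₃ inc) {a} {c} e< (≮⇒≥ y≮)))
  ... | yes _ | yes _ | no z≮ = inj₁ (front-of-low inc {a} {b} e< (≮⇒≥ z≮))
  ... | yes x< | yes y< | yes z<
    with front-or-behind x y a b x< y< | front-or-behind x z a c x< z< | front-or-behind y z b c y< z<
  ... | inj₁ f | _ | _ = inj₁ f
  ... | inj₂ _ | inj₁ f | _ = inj₂ (inj₁ f)
  ... | inj₂ _ | inj₂ _ | inj₁ f = inj₂ (inj₂ f)
  ... | inj₂ (inj₁ x|y) | inj₂ _ | inj₂ (inj₂ z|y) =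
    ⊥-elim (clash (swap₂₃ inc) (weaken {l = a} x|y) (weaken {l = c} z|y))
  ... | inj₂ (inj₁ x|y) | inj₂ _ | inj₂ (inj₁ y|z) =
    ⊥-elim (clash inc (transfer inc {a} x< sx xz x|y) (weaken {l = b} y|z))
  ... | inj₂ (inj₂ y|x) | inj₂ (inj₂ z|x) | inj₂ _ =
    ⊥-elim (clash (swap₂₃ (swap₁₂ inc)) (weaken {l = b} y|x) (weaken {l = c} z|x))
  ... | inj₂ (inj₂ y|x) | inj₂ (inj₁ x|z) | inj₂ _ =
    ⊥-elim (clash inc (weaken {l = a} x|z) (transfer (swap₁₂ inc) {b} y< sy yz y|x))

  cost : (a b c : ℕ) → Fin m → ℕ
  cost a b c e = (misses x y a e + misses x z a e) +
                 ((misses y x b e + misses y z b e) + (misses z x c e + misses z y c e))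

  Box : (a b c A B C β : ℕ) → Fin m → Set
  Box a b c A B C β e =
    (block a (x e) ≡ A × block b (y e) ≡ B × block c (z e) ≡ C) × cost a b c e ≤ β

  box? : ∀ a b c A B C β → Decidable (Box a b c A B C β)
  box? a b c A B C β e =
    ((block a (x e) ≟ A) ×-dec ((block b (y e) ≟ B) ×-dec (block c (z e) ≟ C))) ×-dec
    (cost a b c e ≤? β)

  BoxBound : ℕ → (a b c β : ℕ) → Set
  BoxBound N a b c β = ∀ A B C → AtMost N (Box a b c A B C β)

  module _ (a b c : ℕ) where

    costx-mono : ∀ e → misses x y a e + misses x z a e ≤ misses x y (suc a) e + misses x z (suc a) e
    costx-mono e = +-mono-≤ (misses-mono x y a e) (misses-mono x z a e)
    costy-mono : ∀ e → misses y x b e + misses y z b e ≤ misses y x (suc b) e + misses y z (suc b) e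
    costy-mono e = +-mono-≤ (misses-mono y x b e) (misses-mono y z b e)
    costz-mono : ∀ e → misses z x c e + misses z y c e ≤ misses z x (suc c) e + misses z y (suc c) e
    costz-mono e = +-mono-≤ (misses-mono z x c e) (misses-mono z y c e)

    -- Fullness of the first element `e₀` forces every later one onto a front of `e₀`. Each of the
    -- three fronts occupies at most `(K + K) * 3` subboxes, one level thinner in two directions;
    -- the `1` counts `e₀` itself.
    atMost-full : ∀ {N β} → BoxBound N a b (suc c) β → BoxBound N a (suc b) c β → BoxBound N (suc a) b c β →
      ∀ A B C → AtMost (1 + ((K + K) * 3 * N + ((K + K) * 3 * N + (K + K) * 3 * N)))
                       (λ e → Box (suc a) (suc b) (suc c) A B C β e × Full a b c e)
    atMost-full {N} {β} xy≤N xz≤N yz≤N A B C = atMost-pointed P? λ p → cover (first P? p)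
      where
      P : Fin m → Set
      P e = Box (suc a) (suc b) (suc c) A B C β e × Full a b c e

      P? : Decidable P
      P? e = box? (suc a) (suc b) (suc c) A B C β e ×-dec
        ((visits? x y a e ×-dec visits? x z a e) ×-dec
        ((visits? y x b e ×-dec visits? y z b e) ×-dec
         (visits? z x c e ×-dec visits? z y c e)))

      cover : (∃ λ e₀ → P e₀ × (∀ {e} → P e → e₀ ≡ e ⊎ e₀ <ᶠ e)) →
              AtMost (1 + ((K + K) * 3 * N + ((K + K) * 3 * N + (K + K) * 3 * N))) P
      -- Matching on `refl` turns `A`, `B`, `C` into the blocks of `e₀`, so lying in the box means
      -- being a sibling of `e₀` in each coordinate.
      cover (e₀ , (((refl , refl , refl) , _) , full@((xy , xz) , (yx , yz) , (zx , zy))) , later) =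
        atMost-∪ classify (atMost-unique λ { refl refl → refl })
          (atMost-∪ (λ s → s)
            (atMost-front inc {a} {b} (λ e → P? e ×-dec front? x y a b e₀ e) xy yx
              (λ ((((sx , sy , _) , _) , _) , f) → f , sx , sy)
              λ A B → atMost-⊆ (λ {e} (((((_ , _ , sz) , cost≤) , _) , _) , A≡ , B≡) →
                (A≡ , B≡ , sz) ,
                ≤-trans (+-mono-≤ (costx-mono e) (+-monoˡ-≤ _ (costy-mono e))) cost≤) (xy≤N A B _))
          (atMost-∪ (λ s → s)
            (atMost-front (swap₂₃ inc) {a} {c} (λ e → P? e ×-dec front? x z a c e₀ e) xz zx
              (λ ((((sx , _ , sz) , _) , _) , f) → f , sx , sz)
              λ A C → atMost-⊆ (λ {e} (((((_ , sy , _) , cost≤) , _) , _) , A≡ , C≡) →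
                (A≡ , sy , C≡) ,
                ≤-trans (+-mono-≤ (costx-mono e) (+-monoʳ-≤ (misses y x (suc b) e + misses y z (suc b) e) (costz-mono e))) cost≤) (xz≤N A _ C))
            (atMost-front (swap₂₃ (swap₁₂ inc)) {b} {c} (λ e → P? e ×-dec front? y z b c e₀ e) yz zy
              (λ ((((_ , sy , sz) , _) , _) , f) → f , sy , sz)
              λ B C → atMost-⊆ (λ {e} (((((sx , _ , _) , cost≤) , _) , _) , B≡ , C≡) →
                (sx , B≡ , C≡) ,
                ≤-trans (+-monoʳ-≤ (misses x y (suc a) e + misses x z (suc a) e) (+-mono-≤ (costy-mono e) (costz-mono e))) cost≤) (yz≤N _ B C))))
        where
        classify : ∀ {e} → P e → e₀ ≡ e ⊎
          ((P e × Front x y a b e₀ e) ⊎ ((P e × Front x z a c e₀ e) ⊎ (P e × Front y z b c e₀ e)))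
        classify p@(((sx , sy , _) , _) , _) with later p
        ... | inj₁ e₀≡e = inj₁ e₀≡e
        ... | inj₂ e₀<e = inj₂ (Sum.map (p ,_) (Sum.map (p ,_) (p ,_)) (front-cover a b c full e₀<e sx sy))

    -- For elements that fail a visit at level `l`: each of the `K` children is entered with a
    -- budget smaller by one, so the number of children is absorbed by `K ^ β`. With budget zero
    -- there are no such elements.
    atMost-deficient : ∀ {N} (u : Fin m → ℕ) l A {P : ℕ → Fin m → Set} {Q : ℕ → ℕ → Fin m → Set} →
      (∀ {β e} → P β e → block (suc l) (u e) ≡ A) →
      (∀ {e} → ¬ P 0 e) →
      (∀ {β e} → P (suc β) e → Q (block l (u e)) β e) →
      (∀ A β → AtMost (N * K ^ β) (Q A β)) → ∀ β → AtMost (N * K ^ β) (P β)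
    atMost-deficient u l A inA ∅ P⊆Q Q≤ zero = atMost-∅ ∅
    atMost-deficient {N} u l A {P} {Q} inA ∅ P⊆Q Q≤ (suc β) =
      subst (λ M → AtMost M (P (suc β))) (x∙yz≈y∙xz K N (K ^ β))
        (atMost-fibres (λ {e} _ → digit l (u e)) λ i →
          atMost-⊆ (λ {e} (p , d≡) → subst (λ B → Q B β e) (digit-fibre {m} l (inA p) d≡) (P⊆Q p))
            (Q≤ (toℕ i + A * K) β))
      where
      open import Algebra.Properties.CommutativeSemigroup *-commutativeSemigroup using (x∙yz≈y∙xz)

    atMost-box-step : ∀ {N β} → (∀ β → BoxBound (N * K ^ β) a (suc b) (suc c) β) →
      (∀ β → BoxBound (N * K ^ β) (suc a) b (suc c) β) →
      (∀ β → BoxBound (N * K ^ β) (suc a) (suc b) c β) →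
      ∀ {M} → (∀ A B C → AtMost M (λ e → Box (suc a) (suc b) (suc c) A B C β e × Full a b c e)) →
      BoxBound (M + (N * K ^ β + (N * K ^ β + N * K ^ β))) (suc a) (suc b) (suc c) β
    atMost-box-step {N} {β} x≤ y≤ z≤ full≤ A B C =
      atMost-∪ classify (full≤ A B C) (atMost-∪ (λ s → s)
        (atMost-deficient {N} x a A {P = λ β e → Box (suc a) (suc b) (suc c) A B C β e × ¬ (Visits x y a e × Visits x z a e)} {Q = λ A → Box a (suc b) (suc c) A B C}
          (λ (((A≡ , _) , _) , _) → A≡)
          (λ {e} ((_ , cost≤) , ¬ok) → <⇒≱ (x-drop ¬ok) (≤-trans cost≤ z≤n))
          (λ {β} {e} (((_ , B≡ , C≡) , cost≤) , ¬ok) → (refl , B≡ , C≡) , s≤s⁻¹ (≤-trans (x-drop ¬ok) cost≤))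
          (λ A β → x≤ β A B C) β)
        (atMost-∪ (λ s → s)
        (atMost-deficient {N} y b B {P = λ β e → Box (suc a) (suc b) (suc c) A B C β e × ¬ (Visits y x b e × Visits y z b e)} {Q = λ B → Box (suc a) b (suc c) A B C}
          (λ (((_ , B≡ , _) , _) , _) → B≡)
          (λ {e} ((_ , cost≤) , ¬ok) → <⇒≱ (y-drop ¬ok) (≤-trans cost≤ z≤n))
          (λ {β} {e} (((A≡ , _ , C≡) , cost≤) , ¬ok) → (A≡ , refl , C≡) , s≤s⁻¹ (≤-trans (y-drop ¬ok) cost≤))
          (λ B β → y≤ β A B C) β)
        (atMost-deficient {N} z c C {P = λ β e → Box (suc a) (suc b) (suc c) A B C β e × ¬ (Visits z x c e × Visits z y c e)} {Q = λ C → Box (suc a) (suc b) c A B C}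
          (λ (((_ , _ , C≡) , _) , _) → C≡)
          (λ {e} ((_ , cost≤) , ¬ok) → <⇒≱ (z-drop ¬ok) (≤-trans cost≤ z≤n))
          (λ {β} {e} (((A≡ , B≡ , _) , cost≤) , ¬ok) → (A≡ , B≡ , refl) , s≤s⁻¹ (≤-trans (z-drop ¬ok) cost≤))
          (λ C β → z≤ β A B C) β)))
      where
      x-drop : ∀ {e} → ¬ (Visits x y a e × Visits x z a e) → cost a (suc b) (suc c) e < cost (suc a) (suc b) (suc c) e
      x-drop {e} ¬ok = +-monoˡ-≤ _ (misses-step x y z a e ¬ok)
      y-drop : ∀ {e} → ¬ (Visits y x b e × Visits y z b e) → cost (suc a) b (suc c) e < cost (suc a) (suc b) (suc c) e
      y-drop {e} ¬ok = +-monoʳ-< (misses x y (suc a) e + misses x z (suc a) e) (+-monoˡ-≤ _ (misses-step y x z b e ¬ok))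
      z-drop : ∀ {e} → ¬ (Visits z x c e × Visits z y c e) → cost (suc a) (suc b) c e < cost (suc a) (suc b) (suc c) e
      z-drop {e} ¬ok = +-monoʳ-< (misses x y (suc a) e + misses x z (suc a) e)
        (+-monoʳ-< (misses y x (suc b) e + misses y z (suc b) e) (misses-step z x y c e ¬ok))
      classify : ∀ {e} → Box (suc a) (suc b) (suc c) A B C β e →
        (Box (suc a) (suc b) (suc c) A B C β e × Full a b c e) ⊎
        ((Box (suc a) (suc b) (suc c) A B C β e × ¬ (Visits x y a e × Visits x z a e)) ⊎
        ((Box (suc a) (suc b) (suc c) A B C β e × ¬ (Visits y x b e × Visits y z b e)) ⊎
         (Box (suc a) (suc b) (suc c) A B C β e × ¬ (Visits z x c e × Visits z y c e))))
      classify {e} p with visits? x y a e ×-dec visits? x z a e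
                        | visits? y x b e ×-dec visits? y z b e
                        | visits? z x c e ×-dec visits? z y c e
      ... | no ¬ok | _      | _      = inj₂ (inj₁ (p , ¬ok))
      ... | yes _  | no ¬ok | _      = inj₂ (inj₂ (inj₁ (p , ¬ok)))
      ... | yes _  | yes _  | no ¬ok = inj₂ (inj₂ (inj₂ (p , ¬ok)))
      ... | yes x  | yes y  | yes z  = inj₁ (p , x , y , z)

  K≤γ² : K ≤ γ * γ
  K≤γ² = begin
    K                                         ≤⟨ m≤m+n K (K + 0) ⟩
    2 * K                                     ≤⟨ *-monoˡ-≤ K {2} {18} (s≤s (s≤s z≤n)) ⟩
    18 * K                                    ≡⟨ eighteen K ⟩
    3 * ((K + K) * 3)                         ≤⟨ n≤1+n _ ⟩
    1 + 3 * ((K + K) * 3)                     ≤⟨ m≤n+m _ (3 * γ) ⟩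
    3 * γ + (1 + 3 * ((K + K) * 3))           ≤⟨ γ-large ⟩
    γ * γ                                     ∎
    where
    open ≤-Reasoning
    eighteen : ∀ K → 18 * K ≡ 3 * ((K + K) * 3)
    eighteen = solve-∀

  column-bound : ∀ {b c n} → b + c ≡ n → b ≤ c → ∀ β → K ^ b ≤ γ ^ n * K ^ β
  column-bound {b} {c} refl b≤c β = begin
    K ^ b                  ≤⟨ ^-monoˡ-≤ b K≤γ² ⟩
    (γ * γ) ^ b            ≡⟨ cong (λ δ → (γ * δ) ^ b) (*-identityʳ γ) ⟨
    (γ ^ 2) ^ b            ≡⟨ ^-*-assoc γ 2 b ⟩
    γ ^ (2 * b)            ≤⟨ ^-monoʳ-≤ γ (+-monoʳ-≤ b (≤-trans (≤-reflexive (+-identityʳ b)) b≤c)) ⟩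
    γ ^ (b + c)            ≤⟨ m≤m*n (γ ^ (b + c)) (K ^ β) {{m^n≢0 K β}} ⟩
    γ ^ (b + c) * K ^ β    ∎
    where open ≤-Reasoning

  -- With `u` fixed, `v` or `w` alone determines the element, so the shorter side bounds the count;
  -- `K ≤ γ * γ` spreads it over the levels of both sides.
  atMost-slice : ∀ {u v w : Fin m → ℕ} → Increasing u v w → ∀ b c {n} → b + c ≡ n →
    ∀ {P : Fin m → Set} {A B C} → (∀ {e} → P e → u e ≡ A × block b (v e) ≡ B × block c (w e) ≡ C) →
    ∀ β → AtMost (γ ^ n * K ^ β) P
  atMost-slice {u} {v} {w} inc′ b c sum≡ {A = A} {B} {C} inBox β with ≤-total b c
  ... | inj₁ b≤c = atMost-≤ (column-bound sum≡ b≤c β)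
          (atMost-column v b B (proj₁ ∘ proj₂ ∘ inBox)
            λ p p′ → pair-injective inc′ (trans (proj₁ (inBox p)) (sym (proj₁ (inBox p′)))))
  ... | inj₂ c≤b = atMost-≤ (column-bound (trans (+-comm c b) sum≡) c≤b β)
          (atMost-column w c C (proj₂ ∘ proj₂ ∘ inBox)
            λ p p′ → pair-injective (swap₂₃ inc′) (trans (proj₁ (inBox p)) (sym (proj₁ (inBox p′)))))

  -- Once the isolated `1` is replaced by `γ ^ n * K ^ β`, dividing by that quantity leaves exactly
  -- `γ-large`.
  step-bound : ∀ n β → (1 + ((K + K) * 3 * (γ ^ n * K ^ β) + ((K + K) * 3 * (γ ^ n * K ^ β) + (K + K) * 3 * (γ ^ n * K ^ β))))
    + (γ ^ suc n * K ^ β + (γ ^ suc n * K ^ β + γ ^ suc n * K ^ β)) ≤ γ ^ (2 + n) * K ^ β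
  step-bound n β = begin
    (1 + (M * T + (M * T + M * T))) + (γ ^ suc n * K ^ β + (γ ^ suc n * K ^ β + γ ^ suc n * K ^ β))
      ≤⟨ +-monoˡ-≤ _ (+-monoˡ-≤ (M * T + (M * T + M * T)) T≥1) ⟩
    (T + (M * T + (M * T + M * T))) + (γ ^ suc n * K ^ β + (γ ^ suc n * K ^ β + γ ^ suc n * K ^ β))
      ≡⟨ collect M γ (γ ^ n) (K ^ β) ⟩
    (3 * γ + (1 + 3 * M)) * T
      ≤⟨ *-monoˡ-≤ T γ-large ⟩
    (γ * γ) * T
      ≡⟨ expand γ (γ ^ n) (K ^ β) ⟩
    γ ^ (2 + n) * K ^ β ∎
    where
    open ≤-Reasoning
    M = (K + K) * 3
    T = γ ^ n * K ^ β
    T≥1 : 1 ≤ T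
    T≥1 = *-mono-≤ (m^n>0 γ n) (m^n>0 K β)
    collect : ∀ M g p k → (p * k + (M * (p * k) + (M * (p * k) + M * (p * k)))) + ((g * p) * k + ((g * p) * k + (g * p) * k))
              ≡ (3 * g + (1 + 3 * M)) * (p * k)
    collect = solve-∀
    expand : ∀ g p k → (g * g) * (p * k) ≡ (g * (g * p)) * k
    expand = solve-∀

  -- Here `γ` is the growth per level. Full elements pass to boxes with two levels fewer, the others
  -- to boxes with one level and one miss fewer; a box with a level zero is a slice.
  atMost-box : ∀ a b c {n} → a + (b + c) ≡ n → ∀ β → BoxBound (γ ^ n * K ^ β) a b c β
  atMost-box zero b c sum≡ β A B C = atMost-slice inc b c sum≡ proj₁ β
  atMost-box (suc a) zero c sum≡ β A B C =
    atMost-slice (swap₁₂ inc) (suc a) c sum≡ (λ ((A≡ , B≡ , C≡) , _) → B≡ , A≡ , C≡) β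
  atMost-box (suc a) (suc b) zero sum≡ β A B C =
    atMost-slice (swap₂₃ (swap₁₂ (swap₂₃ inc))) (suc b) (suc a)
      (trans (+-comm (suc b) (suc a)) (trans (cong (suc a +_) (sym (+-identityʳ (suc b)))) sum≡))
      (λ ((A≡ , B≡ , C≡) , _) → C≡ , B≡ , A≡) β
  atMost-box (suc a) (suc b) (suc c) refl β A B C =
    atMost-≤ (≤-trans (step-bound n β) (≤-reflexive (cong (λ n → γ ^ n * K ^ β) (sym n₂))))
      (atMost-box-step a b c {γ ^ suc n}
        (λ β → atMost-box a (suc b) (suc c) n₁x β)
        (λ β → atMost-box (suc a) b (suc c) n₁y β)
        (λ β → atMost-box (suc a) (suc b) c n₁z β)
        (atMost-full a b c {γ ^ n * K ^ β}
          (atMost-box a b (suc c) refl β)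
          (atMost-box a (suc b) c (cong (a +_) (sym (+-suc b c))) β)
          (atMost-box (suc a) b c (sym (trans (cong (a +_) (+-suc b c)) (+-suc a (b + c)))) β))
        A B C)
    where
    n = a + (b + suc c)
    n₁x : a + (suc b + suc c) ≡ suc n
    n₁x = +-suc a (b + suc c)
    n₁y : suc a + (b + suc c) ≡ suc n
    n₁y = refl
    n₁z : suc a + (suc b + c) ≡ suc n
    n₁z = cong (λ k → suc (a + k)) (sym (+-suc b c))
    n₂ : suc a + (suc b + suc c) ≡ 2 + n
    n₂ = cong suc n₁x

-- Inequalities for powers

^-distribʳ-* : ∀ a b n → (a * b) ^ n ≡ a ^ n * b ^ n
^-distribʳ-* a b zero    = refl
^-distribʳ-* a b (suc n) rewrite ^-distribʳ-* a b n = interchange a b (a ^ n) (b ^ n)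
  where open import Algebra.Properties.CommutativeSemigroup *-commutativeSemigroup using (interchange)

^-swap : ∀ a b c → (a ^ b) ^ c ≡ (a ^ c) ^ b
^-swap a b c = trans (^-*-assoc a b c) (trans (cong (a ^_) (*-comm b c)) (sym (^-*-assoc a c b)))

^-cancelʳ-≤ : ∀ k .{{_ : NonZero k}} {a b} → a ^ k ≤ b ^ k → a ≤ b
^-cancelʳ-≤ k a^k≤b^k = ≮⇒≥ λ b<a → <⇒≱ (^-monoˡ-< k b<a) a^k≤b^k

n≤2^n : ∀ n → n ≤ 2 ^ n
n≤2^n zero    = z≤n
n≤2^n (suc n) = begin
  1 + n              ≤⟨ +-mono-≤ (m^n>0 2 n) (n≤2^n n) ⟩
  2 ^ n + 2 ^ n      ≡⟨ cong (2 ^ n +_) (+-identityʳ (2 ^ n)) ⟨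
  2 ^ suc n          ∎
  where open ≤-Reasoning

-- Bernoulli's inequality (1 + 1/κ)ⁿ ≥ 1 + n/κ.
bernoulli : ∀ κ n → κ ^ n * (κ + n) ≤ κ * suc κ ^ n
bernoulli κ zero    = ≤-reflexive (base κ)
  where
  base : ∀ κ → 1 * (κ + 0) ≡ κ * 1
  base = solve-∀
bernoulli κ (suc n) = begin
  κ * κ ^ n * (κ + suc n)                      ≤⟨ m≤m+n _ (κ ^ n * n) ⟩
  κ * κ ^ n * (κ + suc n) + κ ^ n * n          ≡⟨ regroup κ (κ ^ n) n ⟩
  suc κ * (κ ^ n * (κ + n))                    ≤⟨ *-monoʳ-≤ (suc κ) (bernoulli κ n) ⟩
  suc κ * (κ * suc κ ^ n)                      ≡⟨ x∙yz≈y∙xz (suc κ) κ (suc κ ^ n) ⟩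
  κ * (suc κ * suc κ ^ n)                      ∎
  where
  open ≤-Reasoning
  open import Algebra.Properties.CommutativeSemigroup *-commutativeSemigroup using (x∙yz≈y∙xz)
  regroup : ∀ κ p n → κ * p * (κ + suc n) + p * n ≡ suc κ * (p * (κ + n))
  regroup = solve-∀

-- Bernoulli at exponent `κ` shows that the ratio `suc κ / κ` has `κ`-th power at least 2, and
-- `2 ^ n` exceeds `n`.
powers-separate : ∀ κ .{{_ : NonZero κ}} n → κ ^ (κ * n) * n ≤ suc κ ^ (κ * n)
powers-separate κ n = begin
  κ ^ (κ * n) * n       ≤⟨ *-monoʳ-≤ (κ ^ (κ * n)) (n≤2^n n) ⟩
  κ ^ (κ * n) * 2 ^ n   ≡⟨ cong (_* 2 ^ n) (^-*-assoc κ κ n) ⟨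
  (κ ^ κ) ^ n * 2 ^ n   ≡⟨ ^-distribʳ-* (κ ^ κ) 2 n ⟨
  (κ ^ κ * 2) ^ n       ≤⟨ ^-monoˡ-≤ n (*-cancelˡ-≤ κ doubling) ⟩
  (suc κ ^ κ) ^ n       ≡⟨ ^-*-assoc (suc κ) κ n ⟩
  suc κ ^ (κ * n)       ∎
  where
  open ≤-Reasoning
  twice : ∀ κ p → κ * (p * 2) ≡ p * (κ + κ)
  twice = solve-∀
  doubling : κ * (κ ^ κ * 2) ≤ κ * suc κ ^ κ
  doubling = ≤-trans (≤-reflexive (twice κ (κ ^ κ))) (bernoulli κ κ)

log-bracket : ∀ N → 1 < N → ∀ x → ∃ λ l → N ^ l ≤ suc x × suc x < N ^ suc l
log-bracket N 1<N zero    = 0 , ≤-refl , subst (1 <_) (sym (*-identityʳ N)) 1<N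
log-bracket N 1<N (suc x) with l , lo , hi ← log-bracket N 1<N x with m≤n⇒m<n∨m≡n hi
... | inj₁ hi′ = l , ≤-trans lo (n≤1+n _) , hi′
... | inj₂ eq  = suc l , ≤-reflexive (sym eq) ,
  subst (_< N ^ suc (suc l)) (sym eq) (^-monoʳ-< N 1<N (n<1+n (suc l)))

-- Cube sequences and tensor powers

lex-< : ∀ {a a′ b} b′ {n} → a < a′ → b < n → a * n + b < a′ * n + b′
lex-< {a} {a′} {b} b′ {n} a<a′ b<n = begin-strict
  a * n + b      <⟨ +-monoʳ-< (a * n) b<n ⟩
  a * n + n      ≡⟨ +-comm (a * n) n ⟩
  suc a * n      ≤⟨ *-monoˡ-≤ n a<a′ ⟩
  a′ * n         ≤⟨ m≤m+n (a′ * n) b′ ⟩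
  a′ * n + b′    ∎
  where open ≤-Reasoning

record CubeSequence (n m : ℕ) : Set where
  field
    {x y z}    : Fin m → ℕ
    increasing : Increasing x y z
    x<n        : ∀ i → x i < n
    y<n        : ∀ i → y i < n
    z<n        : ∀ i → z i < n
open CubeSequence

cube-mono : ∀ {n n′ m} → n ≤ n′ → CubeSequence n m → CubeSequence n′ m
cube-mono n≤n′ s = record
  { increasing = s .increasing
  ; x<n = λ i → <-≤-trans (s .x<n i) n≤n′
  ; y<n = λ i → <-≤-trans (s .y<n i) n≤n′
  ; z<n = λ i → <-≤-trans (s .z<n i) n≤n′
  }

combine-cancel-< : ∀ {m n} (i₁ j₁ : Fin m) (i₂ j₂ : Fin n) →
  combine i₁ i₂ <ᶠ combine j₁ j₂ → i₁ <ᶠ j₁ ⊎ (i₁ ≡ j₁ × i₂ <ᶠ j₂)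
combine-cancel-< {n = n} i₁ j₁ i₂ j₂ i<j with Fin.<-cmp i₁ j₁
... | tri< i₁<j₁ _ _ = inj₁ i₁<j₁
... | tri> _ _ j₁<i₁ = contradiction i<j (Fin.<-asym (Fin.combine-monoˡ-< j₂ i₂ j₁<i₁))
... | tri≈ _ refl _ = inj₂ (refl , +-cancelˡ-< (n * toℕ i₁) _ _
        (subst₂ _<_ (Fin.toℕ-combine i₁ i₂) (Fin.toℕ-combine i₁ j₂) i<j))

module _ {n m n′ m′} (s : CubeSequence n m) (s′ : CubeSequence n′ m′) where

  lex : (Fin m → ℕ) → (Fin m′ → ℕ) → Fin (m * m′) → ℕ
  lex u u′ i = u (proj₁ (Fin.remQuot {m} m′ i)) * n′ + u′ (proj₂ (Fin.remQuot {m} m′ i))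

  lex-bound : ∀ {u u′} → (∀ i → u i < n) → (∀ i → u′ i < n′) → ∀ i → lex u u′ i < n * n′
  lex-bound {u} {u′} u< u′< i =
    subst (lex u u′ i <_) (+-identityʳ (n * n′)) (lex-< 0 (u< _) (u′< _))

  -- Indices and coordinates are both lexicographic. A step of the first index raises two leading
  -- digits, which decide; with equal first indices the leading digits agree and the second factor
  -- decides.
  _⊗_ : CubeSequence (n * n′) (m * m′)
  _⊗_ .x = lex (s .x) (s′ .x)
  _⊗_ .y = lex (s .y) (s′ .y)
  _⊗_ .z = lex (s .z) (s′ .z)
  _⊗_ .x<n = lex-bound (s .x<n) (s′ .x<n)
  _⊗_ .y<n = lex-bound (s .y<n) (s′ .y<n)
  _⊗_ .z<n = lex-bound (s .z<n) (s′ .z<n)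
  _⊗_ .increasing .step {i} {j} i<j
    with combine-cancel-< (proj₁ (Fin.remQuot {m} m′ i)) (proj₁ (Fin.remQuot {m} m′ j)) _ _
           (subst₂ _<ᶠ_ (sym (Fin.combine-remQuot {m} m′ i)) (sym (Fin.combine-remQuot {m} m′ j)) i<j)
  ... | inj₁ i₁<j₁ =
    Sum.map (Product.map ox oy) (Sum.map (Product.map ox oz) (Product.map oy oz))
      (s .increasing .step i₁<j₁)
    where
    ox = λ lt → lex-< (s′ .x (proj₂ (Fin.remQuot {m} m′ j))) lt (s′ .x<n _)
    oy = λ lt → lex-< (s′ .y (proj₂ (Fin.remQuot {m} m′ j))) lt (s′ .y<n _)
    oz = λ lt → lex-< (s′ .z (proj₂ (Fin.remQuot {m} m′ j))) lt (s′ .z<n _)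
  ... | inj₂ (i₁≡j₁ , i₂<j₂) =
    Sum.map (Product.map (inner (s .x)) (inner (s .y)))
      (Sum.map (Product.map (inner (s .x)) (inner (s .z))) (Product.map (inner (s .y)) (inner (s .z))))
      (s′ .increasing .step i₂<j₂)
    where
    inner : ∀ (u : Fin m → ℕ) {b b′} → b < b′ →
      u (proj₁ (Fin.remQuot {m} m′ i)) * n′ + b < u (proj₁ (Fin.remQuot {m} m′ j)) * n′ + b′
    inner u {b} {b′} b<b′ =
      subst (λ k → u (proj₁ (Fin.remQuot {m} m′ i)) * n′ + b < u k * n′ + b′) i₁≡j₁
        (+-monoʳ-< (u (proj₁ (Fin.remQuot {m} m′ i)) * n′) b<b′)

_^⊗_ : ∀ {n m} → CubeSequence n m → ∀ k → CubeSequence (n ^ k) (m ^ k)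
s ^⊗ zero = record
  { x = λ _ → 0 ; y = λ _ → 0 ; z = λ _ → 0
  ; increasing = record { step = λ { {Fin.zero} {Fin.zero} () } }
  ; x<n = λ _ → ≤-refl ; y<n = λ _ → ≤-refl ; z<n = λ _ → ≤-refl }
s ^⊗ suc k = s ⊗ (s ^⊗ k)

pair-bound : ∀ {m r s} {u v w : Fin m → ℕ} → Increasing u v w →
  (∀ i → u i < r) → (∀ i → v i < s) → m ≤ r * s
pair-bound inc u<r v<s = Fin.injective⇒≤ {f = λ i → combine (fromℕ< (u<r i)) (fromℕ< (v<s i))} λ {i} {j} eq →
  let u≡ , v≡ = Fin.combine-injective (fromℕ< (u<r i)) (fromℕ< (v<s i)) (fromℕ< (u<r j)) (fromℕ< (v<s j)) eq in
  pair-injective inc (Fin.fromℕ<-injective _ _ (u<r i) (u<r j) u≡) (Fin.fromℕ<-injective _ _ (v<s i) (v<s j) v≡)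

-- Power saving in cubes

module _ (κ γ U : ℕ) .{{_ : NonZero γ}}
  (γ-large : 3 * γ + (1 + 3 * ((suc κ + suc κ) * 3)) ≤ γ * γ) where

  private
    K = suc κ
    -- The square of the side `K ^ suc U` with one factor `K` lowered to `κ`.
    ρ = K ^ suc U * (K ^ U * κ)

  -- There are `suc U` levels per unit of `β`. Elements with at least `β` misses for some ordered
  -- pair of coordinates form six porous sets; the rest have total cost at most `6 * β`, and
  -- `γ-small` brings their box bound under `ρ ^ β` as well.
  cube-bound : γ ^ (3 * suc U) * K ^ 6 ≤ ρ →
    ∀ β {m} → CubeSequence ((K ^ suc U) ^ β) m → m ≤ 7 * ρ ^ β
  cube-bound γ-small β {m} s = ≤-trans (atMost-all (λ _ → tt) all≤) 7-terms
    where
    open Counting κ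
    open BoxCounting κ γ γ-large (s .increasing)
    L = suc U * β
    X = K ^ L * (K ^ (L ∸ β) * κ ^ β)
    G = γ ^ (L + (L + L)) * K ^ (6 * β)

    side : ∀ {a} → a < (K ^ suc U) ^ β → a < K ^ L
    side {a} = subst (a <_) (^-*-assoc K (suc U) β)

    Misses≥β : (u v : Fin m → ℕ) → Fin m → Set
    Misses≥β u v e = β ≤ misses u v L e

    Cheap : Fin m → Set
    Cheap = Box L L L 0 0 0 (6 * β)

    classify : ∀ {e} → ⊤ → Misses≥β (s .x) (s .y) e ⊎ Misses≥β (s .x) (s .z) e ⊎ Misses≥β (s .y) (s .x) e ⊎
      Misses≥β (s .y) (s .z) e ⊎ Misses≥β (s .z) (s .x) e ⊎ Misses≥β (s .z) (s .y) e ⊎ Cheap e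
    classify {e} _
      with β ≤? misses (s .x) (s .y) L e | β ≤? misses (s .x) (s .z) L e | β ≤? misses (s .y) (s .x) L e
         | β ≤? misses (s .y) (s .z) L e | β ≤? misses (s .z) (s .x) L e | β ≤? misses (s .z) (s .y) L e
    ... | yes p | _ | _ | _ | _ | _ = inj₁ p
    ... | no _ | yes p | _ | _ | _ | _ = inj₂ (inj₁ p)
    ... | no _ | no _ | yes p | _ | _ | _ = inj₂ (inj₂ (inj₁ p))
    ... | no _ | no _ | no _ | yes p | _ | _ = inj₂ (inj₂ (inj₂ (inj₁ p)))
    ... | no _ | no _ | no _ | no _ | yes p | _ = inj₂ (inj₂ (inj₂ (inj₂ (inj₁ p))))
    ... | no _ | no _ | no _ | no _ | no _ | yes p = inj₂ (inj₂ (inj₂ (inj₂ (inj₂ (inj₁ p)))))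
    ... | no n₁ | no n₂ | no n₃ | no n₄ | no n₅ | no n₆ = inj₂ (inj₂ (inj₂ (inj₂ (inj₂ (inj₂
            ((block-≡0 L (side (s .x<n e)) , block-≡0 L (side (s .y<n e)) , block-≡0 L (side (s .z<n e))) ,
             ≤-trans (+-mono-≤ (+-mono-≤ (≰⇒≥ n₁) (≰⇒≥ n₂)) (+-mono-≤ (+-mono-≤ (≰⇒≥ n₃) (≰⇒≥ n₄)) (+-mono-≤ (≰⇒≥ n₅) (≰⇒≥ n₆))))
                     (≤-reflexive (six β))))))))
      where
      open Blocks κ
      six : ∀ β → (β + β) + ((β + β) + (β + β)) ≡ 6 * β
      six = solve-∀

    porous≤X : ∀ {u v w : Fin m → ℕ} → Increasing u v w → (∀ i → u i < (K ^ suc U) ^ β) →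
      (∀ i → v i < (K ^ suc U) ^ β) → AtMost X (Misses≥β u v)
    porous≤X inc u< v< = atMost-porous inc L β (side ∘ u<) (side ∘ v<)

    all≤ : AtMost (X + (X + (X + (X + (X + (X + G)))))) (λ (_ : Fin m) → ⊤)
    all≤ = atMost-∪ classify (porous≤X inc (s .x<n) (s .y<n))
      (atMost-∪ (λ t → t) (porous≤X (swap₂₃ inc) (s .x<n) (s .z<n))
      (atMost-∪ (λ t → t) (porous≤X (swap₁₂ inc) (s .y<n) (s .x<n))
      (atMost-∪ (λ t → t) (porous≤X (swap₂₃ (swap₁₂ inc)) (s .y<n) (s .z<n))
      (atMost-∪ (λ t → t) (porous≤X (swap₁₂ (swap₂₃ inc)) (s .z<n) (s .x<n))
      (atMost-∪ (λ t → t) (porous≤X (swap₂₃ (swap₁₂ (swap₂₃ inc))) (s .z<n) (s .y<n))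
      (atMost-box L L L refl (6 * β) 0 0 0))))))
      where inc = s .increasing

    X≡ : X ≡ ρ ^ β
    X≡ = begin
      K ^ L * (K ^ (L ∸ β) * κ ^ β)              ≡⟨ cong (λ l → K ^ L * (K ^ l * κ ^ β)) (m+n∸m≡n β (U * β)) ⟩
      K ^ L * (K ^ (U * β) * κ ^ β)              ≡⟨ cong₂ (λ p q → p * (q * κ ^ β)) (^-*-assoc K (suc U) β) (^-*-assoc K U β) ⟨
      (K ^ suc U) ^ β * ((K ^ U) ^ β * κ ^ β)    ≡⟨ cong ((K ^ suc U) ^ β *_) (^-distribʳ-* (K ^ U) κ β) ⟨
      (K ^ suc U) ^ β * (K ^ U * κ) ^ β          ≡⟨ ^-distribʳ-* (K ^ suc U) (K ^ U * κ) β ⟨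
      ρ ^ β                                      ∎
      where open ≡-Reasoning

    G≤ : G ≤ ρ ^ β
    G≤ = begin
      γ ^ (L + (L + L)) * K ^ (6 * β)            ≡⟨ cong (λ l → γ ^ l * K ^ (6 * β)) (triple (suc U) β) ⟩
      γ ^ (3 * suc U * β) * K ^ (6 * β)          ≡⟨ cong₂ _*_ (^-*-assoc γ (3 * suc U) β) (^-*-assoc K 6 β) ⟨
      (γ ^ (3 * suc U)) ^ β * (K ^ 6) ^ β        ≡⟨ ^-distribʳ-* (γ ^ (3 * suc U)) (K ^ 6) β ⟨
      (γ ^ (3 * suc U) * K ^ 6) ^ β              ≤⟨ ^-monoˡ-≤ β γ-small ⟩
      ρ ^ β                                      ∎
      where
      open ≤-Reasoning
      triple : ∀ u β → u * β + (u * β + u * β) ≡ 3 * u * β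
      triple = solve-∀

    7-terms : X + (X + (X + (X + (X + (X + G))))) ≤ 7 * ρ ^ β
    7-terms = begin
      X + (X + (X + (X + (X + (X + G)))))  ≡⟨ six-fold X G ⟩
      6 * X + G                            ≤⟨ +-mono-≤ (≤-reflexive (cong (6 *_) X≡)) G≤ ⟩
      6 * ρ ^ β + ρ ^ β                    ≡⟨ +-comm (6 * ρ ^ β) (ρ ^ β) ⟩
      7 * ρ ^ β                            ∎
      where
      open ≤-Reasoning
      six-fold : ∀ X G → X + (X + (X + (X + (X + (X + G))))) ≡ 6 * X + G
      six-fold = solve-∀

-- The base on the left is `N * N` times `κ / suc κ`, and by `powers-separate` the `Q`-th power of
-- that ratio is at most `1 / N`.
ρ-saving : ∀ κ U .{{_ : NonZero κ}} → let N = suc κ ^ suc U ; Q = κ * N in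
  (N * (suc κ ^ U * κ)) ^ Q * N ≤ N ^ (Q + Q)
ρ-saving κ U = begin
  (N * (K ^ U * κ)) ^ Q * N              ≡⟨ cong (_* N) (^-distribʳ-* N (K ^ U * κ) Q) ⟩
  N ^ Q * (K ^ U * κ) ^ Q * N            ≡⟨ cong (λ p → N ^ Q * p * N) (^-distribʳ-* (K ^ U) κ Q) ⟩
  N ^ Q * ((K ^ U) ^ Q * κ ^ Q) * N      ≡⟨ regroup (N ^ Q) ((K ^ U) ^ Q) (κ ^ Q) N ⟩
  N ^ Q * ((K ^ U) ^ Q * (κ ^ Q * N))    ≤⟨ *-monoʳ-≤ (N ^ Q) (*-monoʳ-≤ ((K ^ U) ^ Q) (powers-separate κ N)) ⟩
  N ^ Q * ((K ^ U) ^ Q * K ^ Q)          ≡⟨ cong (N ^ Q *_) (^-distribʳ-* (K ^ U) K Q) ⟨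
  N ^ Q * (K ^ U * K) ^ Q                ≡⟨ cong (λ p → N ^ Q * p ^ Q) (*-comm (K ^ U) K) ⟩
  N ^ Q * N ^ Q                          ≡⟨ ^-distribˡ-+-* N Q Q ⟨
  N ^ (Q + Q)                            ∎
  where
  open ≤-Reasoning
  K = suc κ
  N = K ^ suc U
  Q = κ * N
  regroup : ∀ a b c d → a * (b * c) * d ≡ a * (b * (c * d))
  regroup = solve-∀

-- A multiplicative constant is absorbed by passing to a large tensor power.
module _ (N ρ P Q : ℕ) (1<N : 1 < N) (ρ^Q≤N^P : ρ ^ Q ≤ N ^ P)
  (bound : ∀ β {m} → CubeSequence (N ^ β) m → m ≤ 7 * ρ ^ β) where

  private
    C = 7 ^ Q * N ^ P
    instance
      N≢0 : NonZero N
      N≢0 = >-nonZero (<-trans z<s 1<N)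
      C²≢0 : NonZero (C * C)
      C²≢0 = >-nonZero (*-mono-≤ C>0 C>0)
        where
        C>0 : 0 < C
        C>0 = *-mono-≤ (m^n>0 7 Q) (m^n>0 N P)

  -- The cube is enlarged to the next power of `N`. This costs at most a factor `N` in the side,
  -- hence `N ^ P`, and the factor 7 contributes `7 ^ Q`.
  bound-with-constant : ∀ {n m} → 1 ≤ n → CubeSequence n m → m ^ Q ≤ C * n ^ P
  bound-with-constant {suc n} {m} _ s with l , lo , hi ← log-bracket N 1<N n = begin
    m ^ Q                             ≤⟨ ^-monoˡ-≤ Q (bound (suc l) (cube-mono (<⇒≤ hi) s)) ⟩
    (7 * ρ ^ suc l) ^ Q               ≡⟨ ^-distribʳ-* 7 (ρ ^ suc l) Q ⟩
    7 ^ Q * (ρ ^ suc l) ^ Q           ≡⟨ cong (7 ^ Q *_) (^-swap ρ (suc l) Q) ⟩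
    7 ^ Q * (ρ ^ Q) ^ suc l           ≤⟨ *-monoʳ-≤ (7 ^ Q) (^-monoˡ-≤ (suc l) ρ^Q≤N^P) ⟩
    7 ^ Q * (N ^ P * (N ^ P) ^ l)     ≡⟨ *-assoc (7 ^ Q) (N ^ P) ((N ^ P) ^ l) ⟨
    C * (N ^ P) ^ l                   ≡⟨ cong (C *_) (^-swap N P l) ⟩
    C * (N ^ l) ^ P                   ≤⟨ *-monoʳ-≤ C (^-monoˡ-≤ P lo) ⟩
    C * suc n ^ P                     ∎
    where
    open ≤-Reasoning

  -- Squaring leaves the constant `C * C`, which one extra factor `n` absorbs.
  bound-large : ∀ {n m} → 1 ≤ n → C * C ≤ n → CubeSequence n m → m ^ (Q + Q) ≤ n ^ suc (P + P)
  bound-large {n} {m} 1≤n C²≤n s = begin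
    m ^ (Q + Q)                    ≡⟨ ^-distribˡ-+-* m Q Q ⟩
    m ^ Q * m ^ Q                  ≤⟨ *-mono-≤ (bound-with-constant 1≤n s) (bound-with-constant 1≤n s) ⟩
    C * n ^ P * (C * n ^ P)        ≡⟨ interchange C (n ^ P) C (n ^ P) ⟩
    C * C * (n ^ P * n ^ P)        ≤⟨ *-monoˡ-≤ (n ^ P * n ^ P) C²≤n ⟩
    n * (n ^ P * n ^ P)            ≡⟨ cong (n *_) (^-distribˡ-+-* n P P) ⟨
    n ^ suc (P + P)                ∎
    where
    open ≤-Reasoning
    open import Algebra.Properties.CommutativeSemigroup *-commutativeSemigroup using (interchange)

  -- Tensoring raises side and length to the same power `k`, so a bound for the tensor power
  -- descends by taking `k`-th roots. For `2 ≤ n` the choice `k = C * C` makes the side large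
  -- enough.
  bound-without-constant : ∀ {n m} → 1 ≤ n → CubeSequence n m → m ^ (Q + Q) ≤ n ^ suc (P + P)
  bound-without-constant {suc zero} {m} _ s = begin
    m ^ (Q + Q)      ≤⟨ ^-monoˡ-≤ (Q + Q) (pair-bound (s .increasing) (s .x<n) (s .y<n)) ⟩
    1 ^ (Q + Q)      ≡⟨ ^-zeroˡ (Q + Q) ⟩
    1                ≡⟨ ^-zeroˡ (suc (P + P)) ⟨
    1 ^ suc (P + P)  ∎
    where open ≤-Reasoning
  bound-without-constant {n@(suc (suc _))} {m} 1≤n s = ^-cancelʳ-≤ k (begin
    (m ^ (Q + Q)) ^ k      ≡⟨ ^-swap m (Q + Q) k ⟩
    (m ^ k) ^ (Q + Q)      ≤⟨ bound-large (m^n>0 n k) k≤n^k (s ^⊗ k) ⟩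
    (n ^ k) ^ suc (P + P)  ≡⟨ ^-swap n k (suc (P + P)) ⟩
    (n ^ suc (P + P)) ^ k  ∎)
    where
    open ≤-Reasoning
    k = C * C
    k≤n^k : k ≤ n ^ k
    k≤n^k = ≤-trans (n≤2^n k) (^-monoˡ-≤ k (s≤s (s≤s z≤n)))

CubeExponent : ℕ → ℕ → Set
CubeExponent P Q = ∀ {n m} → 1 ≤ n → CubeSequence n m → m ^ Q ≤ n ^ P

cube-exponent : ∀ κ γ U .{{_ : NonZero κ}} .{{_ : NonZero γ}} →
  3 * γ + (1 + 3 * ((suc κ + suc κ) * 3)) ≤ γ * γ →
  γ ^ (3 * suc U) * suc κ ^ 6 ≤ suc κ ^ suc U * (suc κ ^ U * κ) →
  ∃ λ P → ∃ λ Q → P < Q + Q × CubeExponent P Q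
cube-exponent κ γ U γ-large γ-small =
  suc (P + P) , Q + Q , P′<2Q′ ,
  bound-without-constant N ρ P Q 1<N ρ^Q≤N^P (cube-bound κ γ U γ-large γ-small)
  where
  N = suc κ ^ suc U
  ρ = N * (suc κ ^ U * κ)
  Q = κ * N
  -- `ρ-saving` gains exactly one factor `N`. With `P` one below `2 Q`, the final exponent `2 P + 1`
  -- is still below `4 Q`.
  P = pred (Q + Q)

  1<N : 1 < N
  1<N = *-mono-≤ {2} {suc κ} {1} (s≤s (>-nonZero⁻¹ κ)) (m^n>0 (suc κ) U)

  Q>0 : 0 < Q
  Q>0 = *-mono-≤ (>-nonZero⁻¹ κ) (<⇒≤ 1<N)

  1+P≡2Q : suc P ≡ Q + Q
  1+P≡2Q = suc-pred (Q + Q) {{>-nonZero (≤-trans Q>0 (m≤m+n Q Q))}}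

  P<2Q : P < Q + Q
  P<2Q = ≤-reflexive 1+P≡2Q

  P′<2Q′ : suc (P + P) < (Q + Q) + (Q + Q)
  P′<2Q′ = ≤-trans (≤-reflexive (cong suc (sym (+-suc P P)))) (+-mono-≤ P<2Q P<2Q)

  ρ^Q≤N^P : ρ ^ Q ≤ N ^ P
  ρ^Q≤N^P = *-cancelʳ-≤ _ _ N {{>-nonZero (<⇒≤ 1<N)}} (begin
    ρ ^ Q * N      ≤⟨ ρ-saving κ U ⟩
    N ^ (Q + Q)    ≡⟨ cong (N ^_) 1+P≡2Q ⟨
    N * N ^ P      ≡⟨ *-comm N (N ^ P) ⟩
    N ^ P * N      ∎)
    where open ≤-Reasoning

-- κ + 1 = 5¹² and γ = 5⁷: γ² must beat 18 (κ + 1), and γ³ must stay below (κ + 1)²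
-- by a margin that 24 + 1 levels per unit of β amplify enough to pay for the factor (κ + 1)⁶.
some-cube-exponent : ∃ λ P → ∃ λ Q → P < Q + Q × CubeExponent P Q
some-cube-exponent = cube-exponent 244140624 78125 24
  (≤ᵇ⇒≤ _ _ tt) (≤ᵇ⇒≤ _ _ tt)

-- From cubes to boxes

-- Used with `t` the largest side, where the enclosing cube supplies `m ^ Q ≤ t ^ P`. The pair bound
-- is raised to the power `P` so that the product becomes a power of `r * s * t`.
combine-bounds : ∀ P Q r s t {m} → m ≤ r * s → m ^ Q ≤ t ^ P → m ^ (P + Q) ≤ (r * s * t) ^ P
combine-bounds P Q r s t {m} m≤rs m^Q≤t^P = begin
  m ^ (P + Q)          ≡⟨ ^-distribˡ-+-* m P Q ⟩
  m ^ P * m ^ Q        ≤⟨ *-mono-≤ (^-monoˡ-≤ P m≤rs) m^Q≤t^P ⟩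
  (r * s) ^ P * t ^ P  ≡⟨ ^-distribʳ-* (r * s) t P ⟨
  (r * s * t) ^ P      ∎
  where open ≤-Reasoning

module _ (P Q : ℕ) (exponent : CubeExponent P Q)
  {r s t m : ℕ} (1≤r : 1 ≤ r) (1≤s : 1 ≤ s) (1≤t : 1 ≤ t)
  (a : Fin m → Triple) (inBox : ∀ i → InBox r s t (a i)) (twoIncreasing : TwoIncreasing a) where

  private
    open import Algebra.Properties.CommutativeSemigroup *-commutativeSemigroup using (xy∙z≈xz∙y; xy∙z≈zx∙y)

    -- Coordinates in a box start at 1, those in a cube sequence at 0.
    u v w : Fin m → ℕ
    u i = pred (proj₁ (a i))
    v i = pred (proj₁ (proj₂ (a i)))
    w i = pred (proj₂ (proj₂ (a i)))

    pred-< : ∀ {k n} → 1 ≤ k × k ≤ n → pred k < n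
    pred-< {suc k} (_ , k<n) = k<n

    u< : ∀ i → u i < r
    u< i = pred-< (proj₁ (inBox i))
    v< : ∀ i → v i < s
    v< i = pred-< (proj₁ (proj₂ (inBox i)))
    w< : ∀ i → w i < t
    w< i = pred-< (proj₂ (proj₂ (inBox i)))

    increasing′ : Increasing u v w
    increasing′ .step {i} {j} i<j =
      let (1≤x , _) , (1≤y , _) , (1≤z , _) = inBox i in
      Sum.map (Product.map (pred-mono-< {{>-nonZero 1≤x}}) (pred-mono-< {{>-nonZero 1≤y}}))
        (Sum.map (Product.map (pred-mono-< {{>-nonZero 1≤x}}) (pred-mono-< {{>-nonZero 1≤z}})) (Product.map (pred-mono-< {{>-nonZero 1≤y}}) (pred-mono-< {{>-nonZero 1≤z}})))
        (twoIncreasing i j i<j)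

    cube : ∀ {n} → r ≤ n → s ≤ n → t ≤ n → CubeSequence n m
    cube r≤ s≤ t≤ = record
      { increasing = increasing′
      ; x<n = λ i → <-≤-trans (u< i) r≤
      ; y<n = λ i → <-≤-trans (v< i) s≤
      ; z<n = λ i → <-≤-trans (w< i) t≤
      }

    t-largest : r ≤ t → s ≤ t → m ^ (P + Q) ≤ (r * s * t) ^ P
    t-largest r≤t s≤t =
      combine-bounds P Q r s t (pair-bound increasing′ u< v<) (exponent 1≤t (cube r≤t s≤t ≤-refl))

    s-largest : r ≤ s → t ≤ s → m ^ (P + Q) ≤ (r * s * t) ^ P
    s-largest r≤s t≤s = subst (λ v → m ^ (P + Q) ≤ v ^ P) (xy∙z≈xz∙y r t s)
      (combine-bounds P Q r t s (pair-bound (swap₂₃ increasing′) u< w<) (exponent 1≤s (cube r≤s ≤-refl t≤s)))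

    r-largest : s ≤ r → t ≤ r → m ^ (P + Q) ≤ (r * s * t) ^ P
    r-largest s≤r t≤r = subst (λ v → m ^ (P + Q) ≤ v ^ P) (xy∙z≈zx∙y s t r)
      (combine-bounds P Q s t r (pair-bound (swap₂₃ (swap₁₂ increasing′)) v< w<) (exponent 1≤r (cube ≤-refl s≤r t≤r)))

  box-bound : m ^ (P + Q) ≤ (r * s * t) ^ P
  box-bound with ≤-total r s | ≤-total s t | ≤-total r t
  ... | inj₁ r≤s | inj₁ s≤t | _        = t-largest (≤-trans r≤s s≤t) s≤t
  ... | inj₁ r≤s | inj₂ t≤s | _        = s-largest r≤s t≤s
  ... | inj₂ s≤r | _        | inj₁ r≤t = t-largest r≤t (≤-trans s≤r r≤t)
  ... | inj₂ s≤r | _        | inj₂ t≤r = r-largest s≤r t≤r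

θ<2/3 : ∀ {P Q} → P < Q + Q → 0 < P + Q × 3 * P < 2 * (P + Q)
θ<2/3 {P} {Q} P<2Q = ≤-trans Q>0 (m≤n+m Q P) , exponent<2/3
  where
  Q>0 : 0 < Q
  Q>0 = n≢0⇒n>0 λ { refl → contradiction P<2Q λ () }
  exponent<2/3 : 3 * P < 2 * (P + Q)
  exponent<2/3 = begin-strict
    3 * P                ≡⟨ lhs P ⟩
    (P + P) + P          <⟨ +-monoʳ-< (P + P) P<2Q ⟩
    (P + P) + (Q + Q)    ≡⟨ rhs P Q ⟩
    2 * (P + Q)          ∎
    where
    open ≤-Reasoning
    lhs : ∀ P → 3 * P ≡ (P + P) + P
    lhs = solve-∀
    rhs : ∀ P Q → (P + P) + (Q + Q) ≡ 2 * (P + Q)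
    rhs = solve-∀

-- The exponent `θ` is the rational number `p / q`, and raising to the power `q` clears the root.
theorem2p1 : Σ ℕ λ p → Σ ℕ λ q → (0 < q) × (3 * p < 2 * q) ×
    (∀ (r s t : ℕ) → 1 ≤ r → 1 ≤ s → 1 ≤ t →
    ∀ (m : ℕ) (a : Fin m → Triple) →
    (∀ i → InBox r s t (a i)) → TwoIncreasing a →
    m ^ q ≤ (r * s * t) ^ p)
theorem2p1 = from-cube some-cube-exponent
  where
  from-cube : (∃ λ P → ∃ λ Q → P < Q + Q × CubeExponent P Q) → _
  from-cube (P , Q , P<2Q , exponent) = P , P + Q , proj₁ (θ<2/3 P<2Q) , proj₂ (θ<2/3 P<2Q) ,
    λ r s t 1≤r 1≤s 1≤t m a inBox inc → box-bound P Q exponent 1≤r 1≤s 1≤t a inBox inc
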